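{- Let $G=(V,E)$ be an undirected graph with edge capacities $c\in\mathbb{R}_{>0}^{E}$, let $s,t\in V$ be distinct vertices, let $\alpha\ge1$, and let $(S,T)$ be an $\alpha$-fair $(s,t)$-cut of $G$. Then for any distinct $u,v\in S$ there exists $R\subset S$ such that $(R,V\setminus R)$ is an $\alpha$-approximate $(u,v)$-mincut, i.e., $R$ contains exactly one of $u,v$ and the total capacity of the edges between $R$ and $V\setminus R$ is at most $\alpha$ times the minimum capacity of a cut separating $u$ from $v$ in $G$.
   Context: A flow is a function $f:V\times V\to\mathbb{R}$ with $f(u,v)=-f(v,u)$ and $f(u,v)=0$ whenever $\{u,v\}\notin E$; it is feasible if $|f(u,v)|\le c(u,v)$ for every edge. The net flow out of $v$ is $f(v)=\sum_{u}f(v,u)$. An $(s,t)$-flow is a flow with $f(v)=0$ for all $v\ne s,t$. An $(s,t)$-cut is a partition $(S,T)$ of $V$ with $s\in S$, $t\in T$; $E(S,T)$ is the set of edges between $S$ and $T$. For $\alpha\ge 1$, an $(s,t)$-cut $(S,T)$ is an $\alpha$-fair $(s,t)$-cut if there exists a feasible $(s,t)$-flow $f$ such that $f(u,v)\ge\frac1\alpha c(u,v)$ for every edge $(u,v)\in E(S,T)$ with $u\in S$, $v\in T$. -}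

module Defs where

open import Algebra.Bundles using (CommutativeRing)
import Algebra.Construct.NaturalChoice.Max as Max
import Algebra.Properties.CommutativeMonoid.Sum as Sum
open import Data.Bool.Base using (if_then_else_; _∧_)
open import Data.Fin.Base using (Fin)
open import Data.Fin.Subset using (Subset; _∈_; _∉_; ∁)
open import Data.Fin.Subset.Properties using (_∈?_)
open import Data.Nat.Base using (ℕ)
open import Data.Product.Base using (_×_; ∃-syntax)
open import Data.Sum.Base using (_⊎_)
open import Level using (Level; suc; _⊔_; 0ℓ)
open import Relation.Binary.Bundles using (TotalOrder)
open import Relation.Binary.Core using (Rel)
open import Relation.Binary.Definitions using (Decidable; Irreflexive; Symmetric)
open import Relation.Binary.PropositionalEquality.Core using (_≡_; _≢_)
open import Relation.Binary.Structures using (IsTotalOrder)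
open import Relation.Nullary.Decidable.Core using (does)
open import Relation.Nullary.Negation.Core using (¬_)

-- A linearly ordered field.  The real numbers are, classically, an instance;
-- completeness plays no role and is not required.  The value of 0# ⁻¹ is
-- unspecified.
record OrderedField (a ℓ₁ ℓ₂ : Level) : Set (suc (a ⊔ ℓ₁ ⊔ ℓ₂)) where
  infix  4 _≤_ _<_
  infix  8 _⁻¹
  field
    commutativeRing : CommutativeRing a ℓ₁

  open CommutativeRing commutativeRing public

  field
    _⁻¹          : Carrier → Carrier
    _≤_          : Rel Carrier ℓ₂
    0≉1          : ¬ 0# ≈ 1#
    ⁻¹-cong      : ∀ {x y} → x ≈ y → x ⁻¹ ≈ y ⁻¹
    ⁻¹-inverseʳ  : ∀ x → ¬ x ≈ 0# → x * x ⁻¹ ≈ 1#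
    isTotalOrder : IsTotalOrder _≈_ _≤_
    +-monoʳ-≤    : ∀ x {y z} → y ≤ z → x + y ≤ x + z
    *-nonNeg     : ∀ {x y} → 0# ≤ x → 0# ≤ y → 0# ≤ x * y

  _<_ : Rel Carrier (ℓ₁ ⊔ ℓ₂)
  x < y = x ≤ y × ¬ x ≈ y

  totalOrder : TotalOrder a ℓ₁ ℓ₂
  totalOrder = record { isTotalOrder = isTotalOrder }

  ∣_∣ : Carrier → Carrier
  ∣ x ∣ = Max._⊔_ totalOrder x (- x)

module Network {a ℓ₁ ℓ₂ : Level} (F : OrderedField a ℓ₁ ℓ₂) where

  open OrderedField F
  open Sum +-commutativeMonoid using (sum-syntax)

  -- A finite simple undirected graph on Fin n with positive edge capacities.
  -- The values of c on non-adjacent pairs are junk and never used.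
  record CapGraph (n : ℕ) : Set (suc 0ℓ ⊔ a ⊔ ℓ₁ ⊔ ℓ₂) where
    field
      Adj        : Rel (Fin n) 0ℓ
      adj?       : Decidable Adj
      adj-sym    : Symmetric Adj
      adj-irrefl : Irreflexive _≡_ Adj
      c          : Fin n → Fin n → Carrier
      c-sym      : ∀ {x y} → Adj x y → c x y ≈ c y x
      c-pos      : ∀ {x y} → Adj x y → 0# < c x y

  module _ {n : ℕ} (G : CapGraph n) where

    open CapGraph G

    record IsFlow (f : Fin n → Fin n → Carrier) : Set ℓ₁ where
      field
        skew    : ∀ x y → f x y ≈ - f y x
        nonEdge : ∀ x y → ¬ Adj x y → f x y ≈ 0#

    IsFeasible : (Fin n → Fin n → Carrier) → Set ℓ₂
    IsFeasible f = ∀ x y → Adj x y → ∣ f x y ∣ ≤ c x y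

    netOut : (Fin n → Fin n → Carrier) → Fin n → Carrier
    netOut f x = ∑[ y < n ] f x y

    IsSTFlow : (s t : Fin n) → (Fin n → Fin n → Carrier) → Set ℓ₁
    IsSTFlow s t f = IsFlow f × (∀ x → x ≢ s → x ≢ t → netOut f x ≈ 0#)

    -- A cut (S , T) is given by its side S, with T = ∁ S.
    IsSTCut : (s t : Fin n) → Subset n → Set
    IsSTCut s t S = s ∈ S × t ∈ ∁ S

    IsFairCut : Carrier → (s t : Fin n) → Subset n → Set (a ⊔ ℓ₁ ⊔ ℓ₂)
    IsFairCut α s t S =
      IsSTCut s t S ×
      (∃[ f ] IsSTFlow s t f × IsFeasible f ×
        (∀ x y → Adj x y → x ∈ S → y ∈ ∁ S → α ⁻¹ * c x y ≤ f x y))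

    -- Each undirected edge between X and ∁ X is counted once, as the ordered
    -- pair whose first component lies in X.
    cutCapacity : Subset n → Carrier
    cutCapacity X =
      ∑[ x < n ] ∑[ y < n ]
        (if does (adj? x y) ∧ does (x ∈? X) ∧ does (y ∈? ∁ X) then c x y else 0#)

    Separates : (u v : Fin n) → Subset n → Set
    Separates u v X = (u ∈ X × v ∉ X) ⊎ (u ∉ X × v ∈ X)

    IsMinCutValue : (u v : Fin n) → Carrier → Set (ℓ₁ ⊔ ℓ₂)
    IsMinCutValue u v m =
      (∃[ X ] Separates u v X × cutCapacity X ≈ m) ×
      (∀ X → Separates u v X → m ≤ cutCapacity X)

    IsApproxMinCut : Carrier → (u v : Fin n) → Subset n → Set (a ⊔ ℓ₁ ⊔ ℓ₂)
    IsApproxMinCut α u v R =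
      Separates u v R ×
      (∃[ m ] IsMinCutValue u v m × cutCapacity R ≤ α * m)

{-# OPTIONS --safe #-}

-- Let X be a minimum (u,v)-cut; complementing it if necessary, t ∉ X.  Put
-- R = X ∩ S and A = X ∖ S.  The edges of ∂R outside ∂X are those between R and
-- A, where fairness gives c ≤ α f.  As s, t ∉ A, the net flow into A vanishes,
-- so the flow entering A from R leaves A through edges of ∂X that are not in
-- ∂R, which by feasibility carry at most their capacity.
-- Hence c(∂R) ≤ α c(∂X).
module Submission where

import Algebra.Construct.NaturalChoice.Max as Max
import Algebra.Properties.Ring as RingProperties
import Algebra.Properties.Semiring.Sum as SemiringSum
open import Data.Bool.Base using (Bool; true; false; if_then_else_; not; _∧_; _xor_)
open import Data.Fin.Base using (Fin; zero; suc)
open import Data.Fin.Subset using (Subset; inside; outside; _∈_; _∉_; _⊂_; ∁; _∩_; ⁅_⁆)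
open import Data.Fin.Subset.Properties using (_∈?_; x∈⁅x⁆; x∈⁅y⁆⇒x≡y; p∩q⊆p; p∩q⊆q; x∈p∩q⁺; x∈p⇒x∉∁p; x∉p⇒x∈∁p)
open import Data.Nat.Base using (ℕ; zero; suc)
open import Data.Product.Base using (_×_; _,_; proj₁; proj₂; ∃-syntax)
open import Data.Sum.Base using (_⊎_; inj₁; inj₂)
open import Data.Vec.Base using ([]; _∷_; lookup)
open import Data.Vec.Properties using ([]=⇒lookup; lookup⇒[]=; lookup-map; lookup-zipWith)
open import Function.Base using (_∘_; flip)
open import Level using (Level)
open import Relation.Binary.Bundles using (TotalOrder)
open import Relation.Binary.PropositionalEquality.Core as ≡ using (_≡_; _≢_)
import Relation.Binary.Reasoning.PartialOrder as PartialOrderReasoning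
import Relation.Binary.Reasoning.Setoid as SetoidReasoning
open import Relation.Nullary.Decidable.Core using (does; yes; no; _×-dec_; _⊎-dec_; ¬?)
open import Relation.Nullary.Negation.Core using (¬_; contradiction)
open import Relation.Unary using (Pred; Decidable)
open import Defs

-- Subsets as bit vectors, and minimisation over them.

does-∈? : ∀ {n} (x : Fin n) (X : Subset n) → does (x ∈? X) ≡ lookup X x
does-∈? zero    (inside  ∷ X) = ≡.refl
does-∈? zero    (outside ∷ X) = ≡.refl
does-∈? (suc x) (_       ∷ X) = does-∈? x X

module _ {a ℓ₁ ℓ₂ : Level} (O : TotalOrder a ℓ₁ ℓ₂) where

  open TotalOrder O using (Carrier; _≤_; refl; trans; total)

  -- Induction on `n`: the subsets containing the first element and those avoiding it are minimised
  -- separately, and `total` compares the two winners.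
  minimal-subset : ∀ {n p} {P : Pred (Subset n) p} → Decidable P → (g : Subset n → Carrier) →
                   (∀ X → ¬ P X) ⊎ (∃[ X ] (P X × (∀ Y → P Y → g X ≤ g Y)))
  minimal-subset {zero} P? g with P? []
  ... | yes P[] = inj₂ ([] , P[] , λ { [] _ → refl })
  ... | no ¬P[] = inj₁ λ { [] → ¬P[] }
  minimal-subset {suc n} P? g
    with minimal-subset (P? ∘ (inside ∷_)) (g ∘ (inside ∷_))
       | minimal-subset (P? ∘ (outside ∷_)) (g ∘ (outside ∷_))
  ... | inj₁ ¬i | inj₁ ¬o = inj₁ λ { (inside ∷ Y) → ¬i Y ; (outside ∷ Y) → ¬o Y }
  ... | inj₁ ¬i | inj₂ (X , PX , minX) = inj₂ (outside ∷ X , PX , λ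
    { (inside ∷ Y) PY → contradiction PY (¬i Y) ; (outside ∷ Y) → minX Y })
  ... | inj₂ (X , PX , minX) | inj₁ ¬o = inj₂ (inside ∷ X , PX , λ
    { (inside ∷ Y) → minX Y ; (outside ∷ Y) PY → contradiction PY (¬o Y) })
  ... | inj₂ (X , PX , minX) | inj₂ (Z , PZ , minZ) with total (g (inside ∷ X)) (g (outside ∷ Z))
  ...   | inj₁ X≤Z = inj₂ (inside ∷ X , PX , λ
    { (inside ∷ Y) → minX Y ; (outside ∷ Y) PY → trans X≤Z (minZ Y PY) })
  ...   | inj₂ Z≤X = inj₂ (outside ∷ Z , PZ , λ
    { (inside ∷ Y) PY → trans Z≤X (minX Y PY) ; (outside ∷ Y) → minZ Y })

module _ {a ℓ₁ ℓ₂ : Level} (F : OrderedField a ℓ₁ ℓ₂) where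

  open OrderedField F hiding (zero)
  open Network F
  open TotalOrder totalOrder using (antisym; total; poset; ≤-respˡ-≈; ≤-respʳ-≈)
    renaming (refl to ≤-refl; reflexive to ≤-reflexive; trans to ≤-trans)
  open RingProperties ring using (-‿involutive; \\-leftDividesʳ; -1*x≈-x; [y-z]x≈yx-zx; x[y-z]≈xy-xz)
  open SemiringSum semiring using (sum; sum-syntax; sum-cong-≋; sum-replicate-zero; ∑-distrib-+; ∑-comm; *-distribˡ-sum)
  module ≤R = PartialOrderReasoning poset
  module ≈R = SetoidReasoning setoid

  -- Inequalities in an ordered field.

  +-mono-≤ : ∀ {w x y z} → w ≤ x → y ≤ z → w + y ≤ x + z
  +-mono-≤ {w} {x} {y} {z} w≤x y≤z = begin
    w + y  ≤⟨ +-monoʳ-≤ w y≤z ⟩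
    w + z  ≈⟨ +-comm w z ⟩
    z + w  ≤⟨ +-monoʳ-≤ z w≤x ⟩
    z + x  ≈⟨ +-comm z x ⟩
    x + z  ∎
    where open ≤R

  +-cancelˡ-≤ : ∀ {x y z} → x + y ≤ x + z → y ≤ z
  +-cancelˡ-≤ {x} {y} {z} x+y≤x+z = begin
    y              ≈⟨ \\-leftDividesʳ x y ⟨
    - x + (x + y)  ≤⟨ +-monoʳ-≤ (- x) x+y≤x+z ⟩
    - x + (x + z)  ≈⟨ \\-leftDividesʳ x z ⟩
    z              ∎
    where open ≤R

  x≤y⇒0≤y-x : ∀ {x y} → x ≤ y → 0# ≤ y - x
  x≤y⇒0≤y-x {x} x≤y = ≤-respˡ-≈ (-‿inverseʳ x) (+-mono-≤ x≤y ≤-refl)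

  0≤y-x⇒x≤y : ∀ {x y} → 0# ≤ y - x → x ≤ y
  0≤y-x⇒x≤y {x} {y} 0≤y-x =
    +-cancelˡ-≤ (≤-trans (≤-reflexive (-‿inverseˡ x)) (≤-respʳ-≈ (+-comm y (- x)) 0≤y-x))

  -- If `1# ≤ 0#`, then `- 1#` is nonnegative, and so is its square, which is `1#`.
  0≤1 : 0# ≤ 1#
  0≤1 with total 0# 1#
  ... | inj₁ 0≤1 = 0≤1
  ... | inj₂ 1≤0 = ≤-respʳ-≈ (trans (-1*x≈-x (- 1#)) (-‿involutive 1#)) (*-nonNeg 0≤-1 0≤-1)
    where
    0≤-1 : 0# ≤ - 1#
    0≤-1 = ≤-respʳ-≈ (+-identityˡ (- 1#)) (x≤y⇒0≤y-x 1≤0)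

  *-monoˡ-≤ : ∀ {x y z} → 0# ≤ x → y ≤ z → x * y ≤ x * z
  *-monoˡ-≤ {x} {y} {z} 0≤x y≤z =
    0≤y-x⇒x≤y (≤-respʳ-≈ (x[y-z]≈xy-xz x z y) (*-nonNeg 0≤x (x≤y⇒0≤y-x y≤z)))

  y≤x*y : ∀ {x y} → 1# ≤ x → 0# ≤ y → y ≤ x * y
  y≤x*y {x} {y} 1≤x 0≤y = 0≤y-x⇒x≤y (≤-respʳ-≈
    (trans ([y-z]x≈yx-zx y x 1#) (+-congˡ (-‿cong (*-identityˡ y))))
    (*-nonNeg (x≤y⇒0≤y-x 1≤x) 0≤y))

  -- Clears the factor `α ⁻¹` from the fairness condition.
  x⁻¹*y≤z⇒y≤x*z : ∀ {x y z} → 1# ≤ x → x ⁻¹ * y ≤ z → y ≤ x * z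
  x⁻¹*y≤z⇒y≤x*z {x} {y} {z} 1≤x x⁻¹y≤z = begin
    y               ≈⟨ *-identityˡ y ⟨
    1# * y          ≈⟨ *-congʳ (⁻¹-inverseʳ x x≉0) ⟨
    x * x ⁻¹ * y    ≈⟨ *-assoc x (x ⁻¹) y ⟩
    x * (x ⁻¹ * y)  ≤⟨ *-monoˡ-≤ (≤-trans 0≤1 1≤x) x⁻¹y≤z ⟩
    x * z           ∎
    where
    open ≤R
    x≉0 : ¬ x ≈ 0#
    x≉0 x≈0 = 0≉1 (antisym 0≤1 (≤-respʳ-≈ x≈0 1≤x))

  -- Halves an inequality without dividing by two: if `y ≤ x`, then `x + x ≤ y + y ≤ x + y`, and `x`
  -- cancels.
  x+x≤y+y⇒x≤y : ∀ {x y} → x + x ≤ y + y → x ≤ y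
  x+x≤y+y⇒x≤y {x} {y} x+x≤y+y with total x y
  ... | inj₁ x≤y = x≤y
  ... | inj₂ y≤x = +-cancelˡ-≤ (≤-trans x+x≤y+y (+-mono-≤ y≤x ≤-refl))

  -- Finite sums and double sums.

  sum-mono-≤ : ∀ {n} {f g : Fin n → Carrier} → (∀ i → f i ≤ g i) → sum f ≤ sum g
  sum-mono-≤ {zero}  f≤g = ≤-refl
  sum-mono-≤ {suc n} f≤g = +-mono-≤ (f≤g zero) (sum-mono-≤ (f≤g ∘ suc))

  ∑∑ : ∀ {n} → (Fin n → Fin n → Carrier) → Carrier
  ∑∑ {n} w = ∑[ x < n ] ∑[ y < n ] w x y

  ∑∑-cong : ∀ {n} {w z : Fin n → Fin n → Carrier} → (∀ x y → w x y ≈ z x y) → ∑∑ w ≈ ∑∑ z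
  ∑∑-cong w≈z = sum-cong-≋ λ x → sum-cong-≋ (w≈z x)

  ∑∑-mono-≤ : ∀ {n} {w z : Fin n → Fin n → Carrier} → (∀ x y → w x y ≤ z x y) → ∑∑ w ≤ ∑∑ z
  ∑∑-mono-≤ w≤z = sum-mono-≤ λ x → sum-mono-≤ (w≤z x)

  ∑∑-distrib-+ : ∀ {n} (w z : Fin n → Fin n → Carrier) →
                 ∑∑ (λ x y → w x y + z x y) ≈ ∑∑ w + ∑∑ z
  ∑∑-distrib-+ {n} w z = trans (sum-cong-≋ λ x → ∑-distrib-+ (w x) (z x)) (∑-distrib-+ {n} _ _)

  *-distribˡ-∑∑ : ∀ {n} k (w : Fin n → Fin n → Carrier) → k * ∑∑ w ≈ ∑∑ (λ x y → k * w x y)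
  *-distribˡ-∑∑ {n} k w = trans (*-distribˡ-sum {n} k _) (sum-cong-≋ λ x → *-distribˡ-sum k (w x))

  -- Cuts are compared pair by pair only after adding both orientations. For a single ordered pair
  -- the comparison can fail: if both endpoints lie in A, the flow term alone may be negative.
  symmetrise : ∀ {n} → (Fin n → Fin n → Carrier) → Fin n → Fin n → Carrier
  symmetrise w x y = w x y + w y x

  ∑∑-symmetrise : ∀ {n} (w : Fin n → Fin n → Carrier) → ∑∑ (symmetrise w) ≈ ∑∑ w + ∑∑ w
  ∑∑-symmetrise w = trans (∑∑-distrib-+ w (flip w)) (+-congˡ (∑-comm (flip w)))

  -- The local inequality for one pair of vertices.

  exit : Bool → Bool → Carrier → Carrier
  exit p q e = if p ∧ not q then e else 0#

  cross : Bool → Bool → Carrier → Carrier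
  cross p q e = if p xor q then e else 0#

  -- The share of a pair `x`, `y` in the net flow into a set, where the Booleans record membership
  -- of `x` and `y` and `g` is the flow from `x` to `y`.
  inflow : Bool → Bool → Carrier → Carrier
  inflow true  true  g = 0#
  inflow true  false g = - g
  inflow false true  g = g
  inflow false false g = 0#

  exit+exit≈cross : ∀ p q {e e′} → e ≈ e′ → exit p q e + exit q p e′ ≈ cross p q e
  exit+exit≈cross true  true  _    = +-identityʳ 0#
  exit+exit≈cross true  false _    = +-identityʳ _
  exit+exit≈cross false true  e≈e′ = trans (+-identityˡ _) (sym e≈e′)
  exit+exit≈cross false false _    = +-identityʳ 0#

  enter+enter≈inflow : ∀ p q {g g′} → g′ ≈ - g →
                       (if q then g else 0#) + (if p then g′ else 0#) ≈ inflow p q g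
  enter+enter≈inflow true  true  g′≈-g = trans (+-congˡ g′≈-g) (-‿inverseʳ _)
  enter+enter≈inflow true  false g′≈-g = trans (+-identityˡ _) g′≈-g
  enter+enter≈inflow false true  _     = +-identityʳ _
  enter+enter≈inflow false false _     = +-identityʳ 0#

  -- The four combinations of (s , x) tell whether an endpoint lies in R = X ∩ S,
  -- S ∖ X, A = X ∖ S or in neither.
  exchange : ∀ {α} → 1# ≤ α → ∀ s x s′ x′ {e g} → 0# ≤ e → g ≤ e → - g ≤ e →
             (s ≡ true → s′ ≡ false → e ≤ α * g) →
             (s ≡ false → s′ ≡ true → e ≤ α * - g) →
             cross (x ∧ s) (x′ ∧ s′) e ≤
             α * (cross x x′ e + inflow (x ∧ not s) (x′ ∧ not s′) g)
  exchange {α} 1≤α s x s′ x′ {e} {g} 0≤e g≤e -g≤e out in′ = cases s x s′ x′ out in′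
    where
    0≤α : 0# ≤ α
    0≤α = ≤-trans 0≤1 1≤α
    same : 0# ≤ α * (0# + 0#)
    same = *-nonNeg 0≤α (≤-reflexive (sym (+-identityʳ 0#)))
    -- The pair is cut by both R and X and has no endpoint in A, so `1# ≤ α` suffices.
    kept : e ≤ α * (e + 0#)
    kept = ≤-respʳ-≈ (*-congˡ (sym (+-identityʳ e))) (y≤x*y 1≤α 0≤e)
    feasible⁻ : 0# ≤ α * (e - g)
    feasible⁻ = *-nonNeg 0≤α (x≤y⇒0≤y-x g≤e)
    feasible⁺ : 0# ≤ α * (e + g)
    feasible⁺ = *-nonNeg 0≤α (≤-respʳ-≈ (+-congˡ (-‿involutive g)) (x≤y⇒0≤y-x -g≤e))
    fair : ∀ {h} → e ≤ α * h → e ≤ α * (0# + h)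
    fair = ≤-respʳ-≈ (*-congˡ (sym (+-identityˡ _)))
    -- The two fairness hypotheses are passed again, so that matching on the Booleans turns their
    -- premises into reflexivity.
    cases : ∀ s x s′ x′ →
            (s ≡ true → s′ ≡ false → e ≤ α * g) →
            (s ≡ false → s′ ≡ true → e ≤ α * - g) →
            cross (x ∧ s) (x′ ∧ s′) e ≤
            α * (cross x x′ e + inflow (x ∧ not s) (x′ ∧ not s′) g)
    cases true  true  true  true  _ _ = same
    cases true  true  true  false _ _ = kept
    -- From R to A: cut by R but not by X, and paid for by the flow into A.
    cases true  true  false true  o _ = fair (o ≡.refl ≡.refl)
    cases true  true  false false _ _ = kept
    cases true  false true  true  _ _ = kept
    cases true  false true  false _ _ = same
    -- Into A from outside X: cut by X but not by R, so the capacity `e` is free to absorb a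
    -- negative `g`.
    cases true  false false true  _ _ = feasible⁺
    cases true  false false false _ _ = same
    cases false true  true  true  _ i = fair (i ≡.refl ≡.refl)
    cases false true  true  false _ _ = feasible⁻
    cases false true  false true  _ _ = same
    cases false true  false false _ _ = feasible⁻
    cases false false true  true  _ _ = kept
    cases false false true  false _ _ = same
    cases false false false true  _ _ = feasible⁺
    cases false false false false _ _ = same

  -- Cut capacities, separating sets and minimum cuts.

  module _ {n : ℕ} (G : CapGraph n) where

    open CapGraph G

    -- Capacity extended by zero to non-adjacent pairs, where `c` is arbitrary, so that bounds hold
    -- for all pairs.
    ĉ : Fin n → Fin n → Carrier
    ĉ x y = if does (adj? x y) then c x y else 0#

    ĉ-sym : ∀ x y → ĉ x y ≈ ĉ y x
    ĉ-sym x y with adj? x y | adj? y x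
    ... | yes xy | yes _  = c-sym xy
    ... | yes xy | no ¬yx = contradiction (adj-sym xy) ¬yx
    ... | no ¬xy | yes yx = contradiction (adj-sym yx) ¬xy
    ... | no _   | no _   = refl

    ĉ-nonNeg : ∀ x y → 0# ≤ ĉ x y
    ĉ-nonNeg x y with adj? x y
    ... | yes xy = proj₁ (c-pos xy)
    ... | no _   = ≤-refl

    exits : Subset n → Fin n → Fin n → Carrier
    exits X x y = exit (lookup X x) (lookup X y) (ĉ x y)

    cutCapacity≈∑∑exits : ∀ X → cutCapacity G X ≈ ∑∑ (exits X)
    cutCapacity≈∑∑exits X = ∑∑-cong term
      where
      term : ∀ x y → (if does (adj? x y) ∧ does (x ∈? X) ∧ does (y ∈? ∁ X) then c x y else 0#)
                     ≈ exits X x y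
      term x y rewrite does-∈? x X | does-∈? y (∁ X) | lookup-map y not X
        with does (adj? x y) | lookup X x | lookup X y
      ... | true  | _     | _     = refl
      ... | false | true  | true  = refl
      ... | false | true  | false = refl
      ... | false | false | _     = refl

    -- Complementing reverses every counted pair; symmetry of `ĉ` and exchanging the two sums undo
    -- this.
    cutCapacity-∁ : ∀ X → cutCapacity G (∁ X) ≈ cutCapacity G X
    cutCapacity-∁ X = begin
      cutCapacity G (∁ X)  ≈⟨ cutCapacity≈∑∑exits (∁ X) ⟩
      ∑∑ (exits (∁ X))     ≈⟨ ∑∑-cong reversed ⟩
      ∑∑ (flip (exits X))  ≈⟨ ∑-comm (flip (exits X)) ⟩
      ∑∑ (exits X)         ≈⟨ cutCapacity≈∑∑exits X ⟨
      cutCapacity G X      ∎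
      where
      open ≈R
      reversed : ∀ x y → exits (∁ X) x y ≈ exits X y x
      reversed x y rewrite lookup-map x not X | lookup-map y not X
        with lookup X x | lookup X y
      ... | true  | true  = refl
      ... | true  | false = refl
      ... | false | true  = ĉ-sym x y
      ... | false | false = refl

    separates? : ∀ u v → Decidable (Separates G u v)
    separates? u v X = ((u ∈? X) ×-dec ¬? (v ∈? X)) ⊎-dec (¬? (u ∈? X) ×-dec (v ∈? X))

    separates-∁ : ∀ {u v X} → Separates G u v X → Separates G u v (∁ X)
    separates-∁ (inj₁ (u∈X , v∉X)) = inj₂ (x∈p⇒x∉∁p u∈X , x∉p⇒x∈∁p v∉X)
    separates-∁ (inj₂ (u∉X , v∈X)) = inj₁ (x∉p⇒x∈∁p u∉X , x∈p⇒x∉∁p v∈X)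

    -- For vertices of `S`, membership in `X ∩ S` is the same as membership in `X`.
    separates-∩ : ∀ {u v X S} → u ∈ S → v ∈ S → Separates G u v X → Separates G u v (X ∩ S)
    separates-∩ {X = X} {S} u∈S _ (inj₁ (u∈X , v∉X)) = inj₁ (x∈p∩q⁺ (u∈X , u∈S) , v∉X ∘ p∩q⊆p X S)
    separates-∩ {X = X} {S} _ v∈S (inj₂ (u∉X , v∈X)) = inj₂ (u∉X ∘ p∩q⊆p X S , x∈p∩q⁺ (v∈X , v∈S))

    -- Strictness is witnessed by whichever of `u` and `v` lies outside `X`.
    separates-∩⇒⊂ : ∀ {u v X S} → u ∈ S → v ∈ S → Separates G u v X → X ∩ S ⊂ S
    separates-∩⇒⊂ {v = v} {X} {S} _ v∈S (inj₁ (_ , v∉X)) = p∩q⊆q X S , v , v∈S , v∉X ∘ p∩q⊆p X S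
    separates-∩⇒⊂ {u = u} {X = X} {S} u∈S _ (inj₂ (u∉X , _)) = p∩q⊆q X S , u , u∈S , u∉X ∘ p∩q⊆p X S

    minCut : ∀ {u v} → u ≢ v →
             ∃[ X ] (Separates G u v X × (∀ Y → Separates G u v Y → cutCapacity G X ≤ cutCapacity G Y))
    minCut {u} {v} u≢v with minimal-subset totalOrder (separates? u v) (cutCapacity G)
    ... | inj₂ min  = min
    -- The singleton `⁅ u ⁆` separates `u` from `v`, so the minimum is over a nonempty family.
    ... | inj₁ none = contradiction
      (inj₁ (x∈⁅x⁆ u , λ v∈⁅u⁆ → u≢v (≡.sym (x∈⁅y⁆⇒x≡y u v∈⁅u⁆)))) (none ⁅ u ⁆)

    -- Bounding the cut of `X ∩ S` by means of the flow that witnesses fairness.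

    module _ {α : Carrier} (1≤α : 1# ≤ α) {s t : Fin n} {S : Subset n} (fairCut : IsFairCut G α s t S) where

      private
        s∈S      = proj₁ (proj₁ fairCut)
        f        = proj₁ (proj₂ fairCut)
        stFlow   = proj₁ (proj₂ (proj₂ fairCut))
        feasible = proj₁ (proj₂ (proj₂ (proj₂ fairCut)))
        fair     = proj₂ (proj₂ (proj₂ (proj₂ fairCut)))
        open IsFlow (proj₁ stFlow)

      f≤ĉ : ∀ x y → f x y ≤ ĉ x y
      f≤ĉ x y with adj? x y
      ... | yes xy = ≤-trans (Max.x≤x⊔y totalOrder (f x y) (- f x y)) (feasible x y xy)
      ... | no ¬xy = ≤-reflexive (nonEdge x y ¬xy)

      -f≤ĉ : ∀ x y → - f x y ≤ ĉ x y
      -f≤ĉ x y = begin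
        - f x y  ≈⟨ skew y x ⟨
        f y x    ≤⟨ f≤ĉ y x ⟩
        ĉ y x    ≈⟨ ĉ-sym y x ⟩
        ĉ x y    ∎
        where open ≤R

      -- On edges this is fairness with `α ⁻¹` cleared; on non-edges both sides vanish.
      ĉ≤α*f : ∀ x y → lookup S x ≡ true → lookup S y ≡ false → ĉ x y ≤ α * f x y
      ĉ≤α*f x y Sx Sy with adj? x y
      ... | yes xy = x⁻¹*y≤z⇒y≤x*z 1≤α (fair x y xy (lookup⇒[]= x S Sx)
                       (lookup⇒[]= y (∁ S) (≡.trans (lookup-map y not S) (≡.cong not Sy))))
      ... | no ¬xy = ≤-reflexive (sym (trans (*-congˡ (nonEdge x y ¬xy)) (zeroʳ α)))

      ĉ≤α*-f : ∀ x y → lookup S x ≡ false → lookup S y ≡ true → ĉ x y ≤ α * - f x y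
      ĉ≤α*-f x y Sx Sy = begin
        ĉ x y        ≈⟨ ĉ-sym x y ⟩
        ĉ y x        ≤⟨ ĉ≤α*f y x Sy Sx ⟩
        α * f y x    ≈⟨ *-congˡ (skew y x) ⟩
        α * - f x y  ∎
        where open ≤R

      -- Summing `exchange` over all ordered pairs gives the bound doubled, since each pair occurs
      -- in both orders; the flow terms add up to zero.
      cutCapacity-∩ : ∀ {X} → t ∉ X → cutCapacity G (X ∩ S) ≤ α * cutCapacity G X
      cutCapacity-∩ {X} t∉X = x+x≤y+y⇒x≤y (begin
        cutCapacity G (X ∩ S) + cutCapacity G (X ∩ S)
          ≈⟨ +-cong (cutCapacity≈∑∑exits (X ∩ S)) (cutCapacity≈∑∑exits (X ∩ S)) ⟩
        ∑∑ (exits (X ∩ S)) + ∑∑ (exits (X ∩ S))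
          ≈⟨ ∑∑-symmetrise (exits (X ∩ S)) ⟨
        ∑∑ (symmetrise (exits (X ∩ S)))
          ≤⟨ ∑∑-mono-≤ pairwise ⟩
        ∑∑ (λ x y → α * (symmetrise (exits X) x y + symmetrise enters x y))
          ≈⟨ *-distribˡ-∑∑ {n} α _ ⟨
        α * ∑∑ (λ x y → symmetrise (exits X) x y + symmetrise enters x y)
          ≈⟨ *-congˡ (∑∑-distrib-+ (symmetrise (exits X)) (symmetrise enters)) ⟩
        α * (∑∑ (symmetrise (exits X)) + ∑∑ (symmetrise enters))
          ≈⟨ *-congˡ (+-cong (∑∑-symmetrise (exits X))
               (trans (∑∑-symmetrise enters) (+-cong noInflow noInflow))) ⟩
        α * (∑∑ (exits X) + ∑∑ (exits X) + (0# + 0#))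
          ≈⟨ *-congˡ (trans (+-congˡ (+-identityʳ 0#)) (+-identityʳ _)) ⟩
        α * (∑∑ (exits X) + ∑∑ (exits X))
          ≈⟨ *-congˡ (+-cong (cutCapacity≈∑∑exits X) (cutCapacity≈∑∑exits X)) ⟨
        α * (cutCapacity G X + cutCapacity G X)
          ≈⟨ distribˡ α _ _ ⟩
        α * cutCapacity G X + α * cutCapacity G X
          ∎)
        where
        open ≤R

        A : Fin n → Bool
        A x = lookup X x ∧ not (lookup S x)

        -- Flow between two vertices of A is included, so that each column in A sums to a full net
        -- flow; these internal terms cancel on symmetrising.
        enters : Fin n → Fin n → Carrier
        enters x y = if A y then f x y else 0#

        pairwise : ∀ x y → symmetrise (exits (X ∩ S)) x y ≤
                           α * (symmetrise (exits X) x y + symmetrise enters x y)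
        pairwise x y rewrite lookup-zipWith _∧_ x X S | lookup-zipWith _∧_ y X S = begin
          exit (Xx ∧ Sx) (Xy ∧ Sy) (ĉ x y) + exit (Xy ∧ Sy) (Xx ∧ Sx) (ĉ y x)
            ≈⟨ exit+exit≈cross (Xx ∧ Sx) (Xy ∧ Sy) (ĉ-sym x y) ⟩
          cross (Xx ∧ Sx) (Xy ∧ Sy) (ĉ x y)
            ≤⟨ exchange 1≤α Sx Xx Sy Xy (ĉ-nonNeg x y) (f≤ĉ x y) (-f≤ĉ x y) (ĉ≤α*f x y) (ĉ≤α*-f x y) ⟩
          α * (cross Xx Xy (ĉ x y) + inflow (A x) (A y) (f x y))
            ≈⟨ *-congˡ (+-cong (exit+exit≈cross Xx Xy (ĉ-sym x y))
                               (enter+enter≈inflow (A x) (A y) (skew y x))) ⟨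
          α * (symmetrise (exits X) x y + symmetrise enters x y)
            ∎
          where
          Xx = lookup X x
          Xy = lookup X y
          Sx = lookup S x
          Sy = lookup S y

        -- Such a `y` differs from `s` because `s ∈ S`, and from `t` because `t ∉ X`.
        conserved : ∀ y → lookup X y ≡ true → lookup S y ≡ false → netOut G f y ≈ 0#
        conserved y Xy Sy = proj₂ stFlow y
          (λ { ≡.refl → contradiction (≡.trans (≡.sym Sy) ([]=⇒lookup s∈S)) λ () })
          (λ { ≡.refl → t∉X (lookup⇒[]= y X Xy) })

        enters-∑ : ∀ y → ∑[ x < n ] enters x y ≈ 0#
        enters-∑ y with lookup X y in Xy | lookup S y in Sy
        ... | false | _     = sum-replicate-zero n
        ... | true  | true  = sum-replicate-zero n
        ... | true  | false = ≈R.begin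
          -- By skew symmetry the column sum is minus the net outflow of `y`; writing the sign as
          -- the factor `- 1#` lets distributivity pull it out of the sum.
          ∑[ x < n ] f x y          ≈R.≈⟨ sum-cong-≋ (λ x → trans (skew x y) (sym (-1*x≈-x (f y x)))) ⟩
          ∑[ x < n ] (- 1# * f y x) ≈R.≈⟨ *-distribˡ-sum (- 1#) (f y) ⟨
          - 1# * netOut G f y       ≈R.≈⟨ *-congˡ (conserved y Xy Sy) ⟩
          - 1# * 0#                 ≈R.≈⟨ zeroʳ (- 1#) ⟩
          0#                        ≈R.∎

        noInflow : ∑∑ enters ≈ 0#
        noInflow = trans (∑-comm enters) (trans (sum-cong-≋ enters-∑) (sum-replicate-zero n))

lemma1p2 : ∀ {a ℓ₁ ℓ₂ : Level} (F : OrderedField a ℓ₁ ℓ₂) →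
           let open OrderedField F
               open Network F
           in
           ∀ (n : ℕ) (G : CapGraph n) (s t : Fin n) → s ≢ t →
           ∀ (α : Carrier) → 1# ≤ α →
           ∀ (S : Subset n) → IsFairCut G α s t S →
           ∀ (u v : Fin n) → u ≢ v → u ∈ S → v ∈ S →
           ∃[ R ] (R ⊂ S × IsApproxMinCut G α u v R)
lemma1p2 F n G s t _ α 1≤α S fairCut u v u≢v u∈S v∈S = approximate (minCut F G u≢v)
  where
  open OrderedField F
  open Network F
  open TotalOrder totalOrder using (≤-respʳ-≈)

  approximate : ∃[ X ] (Separates G u v X × (∀ Y → Separates G u v Y → cutCapacity G X ≤ cutCapacity G Y)) →
                ∃[ R ] (R ⊂ S × IsApproxMinCut G α u v R)
  approximate (X , sep , min) with t ∈? X
  ... | no t∉X  = X ∩ S , separates-∩⇒⊂ F G u∈S v∈S sep , separates-∩ F G u∈S v∈S sep ,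
                  cutCapacity G X , ((X , sep , refl) , min) , cutCapacity-∩ F G 1≤α fairCut t∉X
  -- The complement of `X` avoids `t`, separates the same pair and has the same capacity, so the
  -- capacity of `X` still serves as the minimum value.
  ... | yes t∈X = ∁ X ∩ S , separates-∩⇒⊂ F G u∈S v∈S sep′ , separates-∩ F G u∈S v∈S sep′ ,
                  cutCapacity G X , ((X , sep , refl) , min) ,
                  ≤-respʳ-≈ (*-congˡ (cutCapacity-∁ F G X))
                    (cutCapacity-∩ F G 1≤α fairCut (x∈p⇒x∉∁p t∈X))
    where
    sep′ = separates-∁ F G sep
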